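{- Let $t,h$ be positive integers with $h \leq 2t+1$, and let $G=C_3^tC_6^h$. Then $G$ is graceful or near graceful.
   Context: $C_n^t$ denotes the union of $t$ cycles of length $n$ sharing exactly one common (central) vertex, and $C_3^tC_6^h$ denotes the graph obtained by identifying the central vertices of $C_3^t$ and $C_6^h$. For a graph $G$ with $m$ edges, a graceful labelling is an injective map $f:V(G)\to\{0,\ldots,m\}$ such that $g(uv)=|f(u)-f(v)|$ is a bijection $E(G)\to\{1,\ldots,m\}$. A near graceful labelling is an injective map $f:V(G)\to\{0,\ldots,m+1\}$ such that $g(uv)=|f(u)-f(v)|$ is a bijection onto $\{1,\ldots,m-1,m\}$ or onto $\{1,\ldots,m-1,m+1\}$. -}

module Defs where

open import Data.Nat using (ℕ; zero; suc; _+_; _*_; _∸_; _≤_; ∣_-_∣)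
open import Data.Fin using (Fin; zero; suc)
open import Data.Product using (_×_; _,_; ∃-syntax)
open import Data.Sum using (_⊎_)
open import Relation.Binary.PropositionalEquality using (_≡_)
open import Function.Definitions using (Injective)

-- A (finite, simple) graph given by a vertex type, an edge type and the
-- endpoints of each edge.  The number of edges is supplied separately.
record Graph : Set₁ where
  field
    Vertex   : Set
    Edge     : Set
    ends     : Edge → Vertex × Vertex

open Graph public

edgeLabel : (G : Graph) → (Vertex G → ℕ) → Edge G → ℕ
edgeLabel G f e with ends G e
... | u , v = ∣ f u - f v ∣

LabelledOnto : (G : Graph) → (bound : ℕ) → (ℕ → Set) → (Vertex G → ℕ) → Set
LabelledOnto G bound Target f =
  (∀ v → f v ≤ bound)
  × Injective _≡_ _≡_ f
  × (∀ e → Target (edgeLabel G f e))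
  × Injective _≡_ _≡_ (edgeLabel G f)
  × (∀ k → Target k → ∃[ e ] edgeLabel G f e ≡ k)

Range1 : ℕ → ℕ → Set
Range1 m k = 1 ≤ k × k ≤ m

Graceful : (G : Graph) → (m : ℕ) → Set
Graceful G m = ∃[ f ] LabelledOnto G m (Range1 m) f

NearGraceful : (G : Graph) → (m : ℕ) → Set
NearGraceful G m =
  ∃[ f ] (LabelledOnto G (suc m) (λ k → Range1 (m ∸ 1) k ⊎ k ≡ m) f
          ⊎ LabelledOnto G (suc m) (λ k → Range1 (m ∸ 1) k ⊎ k ≡ suc m) f)

-- The graph C_3^t C_6^h : t triangles and h hexagons sharing one
-- central vertex.

data CVertex (t h : ℕ) : Set where
  centre : CVertex t h
  tri    : Fin t → Fin 2 → CVertex t h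
  hex    : Fin h → Fin 5 → CVertex t h

data CEdge (t h : ℕ) : Set where
  triE : Fin t → Fin 3 → CEdge t h
  hexE : Fin h → Fin 6 → CEdge t h

cends : ∀ {t h} → CEdge t h → CVertex t h × CVertex t h
cends (triE i zero)                   = centre , tri i zero
cends (triE i (suc zero))             = tri i zero , tri i (suc zero)
cends (triE i (suc (suc zero)))       = tri i (suc zero) , centre
cends (hexE j zero)                   = centre , hex j zero
cends (hexE j (suc zero))             = hex j zero , hex j (suc zero)
cends (hexE j (suc (suc zero)))       = hex j (suc zero) , hex j (suc (suc zero))
cends (hexE j (suc (suc (suc zero)))) = hex j (suc (suc zero)) , hex j (suc (suc (suc zero)))
cends (hexE j (suc (suc (suc (suc zero))))) =
  hex j (suc (suc (suc zero))) , hex j (suc (suc (suc (suc zero))))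
cends (hexE j (suc (suc (suc (suc (suc zero)))))) =
  hex j (suc (suc (suc (suc zero)))) , centre

C3tC6h : ℕ → ℕ → Graph
C3tC6h t h = record { Vertex = CVertex t h ; Edge = CEdge t h ; ends = cends }

edgesC3tC6h : ℕ → ℕ → ℕ
edgesC3tC6h t h = 3 * t + 6 * h

{-# OPTIONS --safe #-}
-- The centre gets label 0. The triangles come from a pairing of Skolem type, a set of pairs (p, q)
-- whose differences q - p are 1, …, t: translated so that the p, q lie among the largest
-- labels, each pair together with 0 is a triangle with edge labels q - p and the labels of its two vertices.
-- The hexagons alternate between vertices above t and small vertices, and use the remaining edge
-- labels t + 1, t + 2, …. All but at most two of them form two families in which the large
-- vertices advance by 1 and the small ones by 2, so that every edge runs through consecutive labels; the
-- bound h ≤ 2t + 1 keeps the small vertices below the large ones.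
--
-- The labels around each cycle have even sum, so parity decides which labels can be filled. For h even
-- the hexagons fill an interval, and the triangles use a Skolem (t ≡ 0, 1 mod 4, graceful) or a hooked Skolem
-- sequence (t ≡ 2, 3, near graceful). For h odd the hexagons skip one label, which the triangles fill with
-- a reversed hooked (t ≡ 2, 3, graceful) or a doubly hooked sequence (t ≡ 0, 1, near graceful). For t = 1
-- there is no doubly hooked sequence, which leaves h = 1 and h = 3 to explicit labellings.
--
-- By counting, a labelling that attains all edge labels and enough vertex labels is automatically injective.
module Submission where

open import Defs
open import Data.Fin using (Fin; zero; suc)
open import Data.List using (List; []; _∷_; _++_; map; length; lookup; concatMap; allFin; cartesianProductWith)
open import Data.List.Membership.DecPropositional using () renaming (_∈?_ to member?)
open import Data.List.Membership.Propositional using (_∈_; find; lose)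
open import Data.List.Membership.Propositional.Properties using (∈-∃++; ∈-++⁺ˡ; ∈-++⁺ʳ; ∈-map⁺; ∈-concatMap⁺; ∈-concatMap⁻; ∈-cartesianProductWith⁺; ∈-allFin)
open import Data.List.Properties using (length-++; length-map; length-tabulate)
open import Data.List.Relation.Binary.Permutation.Propositional using (_↭_; ↭-refl; ↭-prep; ↭-trans; ↭-sym; ↭⇒↭ₛ)
open import Data.List.Relation.Binary.Permutation.Propositional.Properties using (shift; ∈-resp-↭; ↭-length)
import Data.List.Relation.Binary.Permutation.Setoid.Properties as PermutationSetoid
open import Data.List.Relation.Binary.Subset.Propositional using (_⊆_)
open import Data.List.Relation.Unary.All as All using (All)
import Data.List.Relation.Unary.AllPairs as AllPairs
open import Data.List.Relation.Unary.Any using (Any; here; there; index; any?)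
open import Data.List.Relation.Unary.Any.Properties using (lookup-index)
open import Data.List.Relation.Unary.Unique.Propositional using (Unique)
open import Data.Nat using (ℕ; zero; suc; _+_; _*_; _∸_; _≤_; _<_; z≤n; s≤s; ∣_-_∣; _≟_; _<?_)
open import Data.Nat.ListAction using (sum)
open import Data.Nat.Properties hiding (_≟_; _<?_)
open import Data.Nat.Tactic.RingSolver using (solve)
open import Data.Product using (_×_; _,_; ∃-syntax; proj₁; proj₂)
open import Data.Sum using (_⊎_; inj₁; inj₂)
open import Function using (_∘_)
open import Function.Definitions using (Injective)
open import Relation.Binary.PropositionalEquality
open import Relation.Nullary using (contradiction)
open import Relation.Nullary.Decidable using (Dec; yes; no; from-yes; _⊎-dec_)
open import Relation.Unary using (Decidable)

private
  variable
    A B : Set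
    P Q : ℕ → Set
    a b n p lo hi : ℕ

-- Counting: enough distinct values force injectivity

-- Cut an occurrence of the head of `xs` out of `ys`. The other entries differ from it, so they
-- survive in the remainder, and both lengths drop by one.
uniqueCover⇒↭ : {xs ys : List A} → Unique xs → xs ⊆ ys → length ys ≤ length xs → xs ↭ ys
uniqueCover⇒↭ {xs = []} {[]} _ _ _ = ↭-refl
uniqueCover⇒↭ {xs = x ∷ xs} {ys} (x∉xs AllPairs.∷ xs!) sub len with ∈-∃++ (sub (here refl))
... | as , bs , refl = ↭-trans (↭-prep x (uniqueCover⇒↭ xs! sub′ len′)) (↭-sym (shift x as bs))
  where
  len′ : length (as ++ bs) ≤ length xs
  len′ = ≤-pred (subst (_≤ suc (length xs)) (↭-length (shift x as bs)) len)
  sub′ : xs ⊆ as ++ bs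
  sub′ {y} y∈xs with ∈-resp-↭ (shift x as bs) (sub (there y∈xs))
  ... | here refl = contradiction refl (All.lookup x∉xs y∈xs)
  ... | there y∈ = y∈

unique-map⇒injective : {f : A → B} {as : List A} → Unique (map f as) →
  ∀ {a b} → a ∈ as → b ∈ as → f a ≡ f b → a ≡ b
unique-map⇒injective _         (here refl) (here refl) _  = refl
unique-map⇒injective (a∉ AllPairs.∷ _)  (here refl) (there b∈)  eq = contradiction eq (All.lookup a∉ (∈-map⁺ _ b∈))
unique-map⇒injective (b∉ AllPairs.∷ _)  (there a∈)  (here refl) eq = contradiction (sym eq) (All.lookup b∉ (∈-map⁺ _ a∈))
unique-map⇒injective (_ AllPairs.∷ as!) (there a∈)  (there b∈)  eq = unique-map⇒injective as! a∈ b∈ eq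

-- Pigeonhole: a function on an n-element type that attains n distinct values is injective and attains no others.
module _ (as : List A) (complete : ∀ a → a ∈ as) (f : A → B) {xs : List B} (xs! : Unique xs)
         (hit : ∀ {x} → x ∈ xs → ∃[ a ] f a ≡ x) (len : length as ≤ length xs) where

  private
    perm : xs ↭ map f as
    perm = uniqueCover⇒↭ xs! (λ x∈ → let a , eq = hit x∈ in subst (_∈ map f as) eq (∈-map⁺ f (complete a)))
      (subst (_≤ length xs) (sym (length-map f as)) len)

  exhausted⇒injective : Injective _≡_ _≡_ f
  exhausted⇒injective {a} {b} =
    unique-map⇒injective (PermutationSetoid.Unique-resp-↭ (setoid _) (↭⇒↭ₛ perm) xs!) (complete a) (complete b)

  exhausted⇒∈ : ∀ a → f a ∈ xs
  exhausted⇒∈ a = ∈-resp-↭ (↭-sym perm) (∈-map⁺ f (complete a))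

-- Intervals and increasing runs of attained labels

-- A record instead of a function type, so that unification recovers `P`, `a` and `n`.
record Block (P : ℕ → Set) (a n : ℕ) : Set where
  constructor mkBlock
  field at : ∀ i → i < n → P (a + i)

open Block

-- Quantifying over i + j = n - 1 makes the descending order available without subtraction.
block : (∀ i j → suc (i + j) ≡ n → P (a + i)) → Block P a n
block p .at i i<n = let j , eq = m≤n⇒∃[o]m+o≡n i<n in p i j eq

-- For quantities that fall as the index `i` rises and are therefore counted by `j`, such as right
-- ends of nested chords and edges inside a hexagon family.
blockᵒ : (∀ i j → suc (i + j) ≡ n → P (a + j)) → Block P a n
blockᵒ p = block λ i j eq → p j i (trans (cong suc (+-comm j i)) eq)

single : P a → Block P a 1
single {P} {a} pa .at zero    _          = subst P (sym (+-identityʳ a)) pa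
single         pa .at (suc _) (s≤s ())

mapBlock : (∀ {x} → P x → Q x) → Block P a n → Block Q a n
mapBlock f b .at i i<n = f (at b i i<n)

translate : ∀ c → (∀ {x} → P x → Q (c + x)) → Block P a n → Block Q (c + a) n
translate {Q = Q} {a} c f b .at i i<n = subst Q (sym (+-assoc c a i)) (f (at b i i<n))

infixl 4 _▸_
_▸_ : Block P a n → Block P (a + n) p → Block P a (n + p)
_▸_ {P} {a} {n} left right .at i i<n+p with i <? n
... | yes i<n = at left i i<n
... | no i≮n with m≤n⇒∃[o]m+o≡n (≮⇒≥ i≮n)
...   | j , refl = subst P (+-assoc a n j) (at right j (+-cancelˡ-< n j _ i<n+p))

block∋ : ∀ {x} → Block P a n → a ≤ x → x < a + n → P x
block∋ {a = a} b a≤x x<a+n with m≤n⇒∃[o]m+o≡n a≤x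
... | i , refl = at b i (+-cancelˡ-< a i _ x<a+n)

halve : ∀ i → ∃[ q ] (i ≡ q + q ⊎ i ≡ suc (q + q))
halve zero = 0 , inj₁ refl
halve (suc i) with halve i
... | q , inj₁ refl = q , inj₂ refl
... | q , inj₂ refl = suc q , inj₁ (cong suc (sym (+-suc q q)))

q+q<n+n⇒q<n : ∀ q n → q + q < n + n → q < n
q+q<n+n⇒q<n q n lt = ≰⇒> λ n≤q → <⇒≱ lt (+-mono-≤ n≤q n≤q)

-- Joins two sequences of step 2: the odd and the even differences of a pairing, or the small
-- vertices of the two long hexagon families.
interleave : ∀ a → Block (λ x → P (a + (x + x))) 0 n → Block (λ x → P (suc (a + (x + x)))) 0 n → Block P a (n + n)
interleave {P} {n} a evens odds .at i i<n+n with halve i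
... | q , inj₁ refl = at evens q (q+q<n+n⇒q<n q n i<n+n)
... | q , inj₂ refl = subst P (sym (+-suc a (q + q))) (at odds q (q+q<n+n⇒q<n q n (<-trans (n<1+n _) i<n+n)))

-- n numbers satisfying P, listed increasingly within [lo, hi).
data Run (P : ℕ → Set) (lo hi : ℕ) : ℕ → Set where
  end  : lo ≤ hi → Run P lo hi 0
  next : ∀ {x} → lo ≤ x → P x → Run P (suc x) hi n → Run P lo hi (suc n)

weaken : lo ≤ a → Run P a hi n → Run P lo hi n
weaken lo≤a (end a≤hi)       = end (≤-trans lo≤a a≤hi)
weaken lo≤a (next a≤x px r) = next (≤-trans lo≤a a≤x) px r

append : Run P lo a n → a ≤ b → Run P b hi p → Run P lo hi (n + p)
append (end lo≤a)       a≤b r′ = weaken (≤-trans lo≤a a≤b) r′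
append (next lo≤x px r) a≤b r′ = next lo≤x px (append r a≤b r′)

blockRun : Block P a n → Run P a (a + n) n
blockRun {P} {a} {zero} b = end (m≤m+n a 0)
blockRun {P} {a} {suc n} b = next ≤-refl (subst P (+-identityʳ a) (at b 0 (s≤s z≤n)))
  (subst (λ hi → Run P (suc a) hi n) (sym (+-suc a n))
    (blockRun (mkBlock λ i i<n → subst P (+-suc a i) (at b (suc i) (s≤s i<n)))))

infixl 4 _▹_after_by_
-- Vertex labels leave gaps; `g` is the number of labels passed over before the next block.
_▹_after_by_ : Run P lo a n → Block P b p → ∀ g → b ≡ a + g → Run P lo (b + p) (n + p)
_▹_after_by_ {a = a} r b g refl = append r (m≤m+n a g) (blockRun b)

mapRun : (∀ {x} → P x → Q x) → Run P lo hi n → Run Q lo hi n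
mapRun f (end lo≤hi)      = end lo≤hi
mapRun f (next lo≤x px r) = next lo≤x (f px) (mapRun f r)

values : Run P lo hi n → List ℕ
values (end _)              = []
values (next {x = x} _ _ r) = x ∷ values r

values-length : (r : Run P lo hi n) → length (values r) ≡ n
values-length (end _)      = refl
values-length (next _ _ r) = cong suc (values-length r)

values-satisfy : (r : Run P lo hi n) → All P (values r)
values-satisfy (end _)       = All.[]
values-satisfy (next _ px r) = px All.∷ values-satisfy r

run-lo≤hi : Run P lo hi n → lo ≤ hi
run-lo≤hi (end lo≤hi)      = lo≤hi
run-lo≤hi (next lo≤x _ r) = ≤-trans lo≤x (≤-trans (n≤1+n _) (run-lo≤hi r))

values-≥ : (r : Run P lo hi n) → All (lo ≤_) (values r)
values-≥ (end _)         = All.[]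
values-≥ (next lo≤x _ r) = lo≤x All.∷ All.map (λ sx≤y → ≤-trans lo≤x (<⇒≤ sx≤y)) (values-≥ r)

values-< : (r : Run P lo hi n) → All (_< hi) (values r)
values-< (end _)         = All.[]
values-< (next lo≤x _ r) = run-lo≤hi r All.∷ values-< r

values-unique : (r : Run P lo hi n) → Unique (values r)
values-unique (end _)      = AllPairs.[]
values-unique (next _ _ r) = All.map <⇒≢ (values-≥ r) AllPairs.∷ values-unique r

-- From lists of labelled cycles to labellings of the graph

Triangle : Set
Triangle = ℕ × ℕ

record Hexagon : Set where
  constructor hexagon
  field v₁ v₂ v₃ v₄ v₅ : ℕ

open Hexagon

-- The centre carries 0, so the label of each neighbour of the centre is also the label of the edge
-- joining them.
triVertices triEdges : Triangle → List ℕ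
triVertices (x , y) = x ∷ y ∷ []
triEdges    (x , y) = x ∷ ∣ x - y ∣ ∷ y ∷ []

hexVertices hexEdges : Hexagon → List ℕ
hexVertices (hexagon v₁ v₂ v₃ v₄ v₅) = v₁ ∷ v₂ ∷ v₃ ∷ v₄ ∷ v₅ ∷ []
hexEdges    (hexagon v₁ v₂ v₃ v₄ v₅) = v₁ ∷ ∣ v₁ - v₂ ∣ ∷ ∣ v₂ - v₃ ∣ ∷ ∣ v₃ - v₄ ∣ ∷ ∣ v₄ - v₅ ∣ ∷ v₅ ∷ []

TriVertex TriEdge : List Triangle → ℕ → Set
TriVertex T x = x ∈ concatMap triVertices T
TriEdge   T x = x ∈ concatMap triEdges T

HexVertex HexEdge : List Hexagon → ℕ → Set
HexVertex H x = x ∈ concatMap hexVertices H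
HexEdge   H x = x ∈ concatMap hexEdges H

VertexLabel EdgeLabel : List Triangle → List Hexagon → ℕ → Set
VertexLabel T H x = x ≡ 0 ⊎ TriVertex T x ⊎ HexVertex H x
EdgeLabel   T H x = TriEdge T x ⊎ HexEdge H x

locate : {f : A → List B} {as : List A} {x : B} → x ∈ concatMap f as → ∃[ i ] x ∈ f (lookup as i)
locate {f = f} {as} x∈ = let any = ∈-concatMap⁻ f {xs = as} x∈ in index any , lookup-index any

length-cartesianProductWith : {C : Set} (f : A → B → C) (as : List A) (bs : List B) →
  length (cartesianProductWith f as bs) ≡ length as * length bs
length-cartesianProductWith f []       bs = refl
length-cartesianProductWith f (a ∷ as) bs = trans (length-++ (map (f a) bs))
  (cong₂ _+_ (length-map (f a) bs) (length-cartesianProductWith f as bs))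

length-allFin : ∀ n → length (allFin n) ≡ n
length-allFin n = length-tabulate {n = n} (λ i → i)

length-grid : {C : Set} (m n : ℕ) (f : Fin m → Fin n → C) → length (cartesianProductWith f (allFin m) (allFin n)) ≡ m * n
length-grid m n f = trans (length-cartesianProductWith f (allFin m) (allFin n)) (cong₂ _*_ (length-allFin m) (length-allFin n))

module _ (t h : ℕ) where

  vertices : List (CVertex t h)
  vertices = centre ∷ cartesianProductWith tri (allFin t) (allFin 2) ++ cartesianProductWith hex (allFin h) (allFin 5)

  edges : List (CEdge t h)
  edges = cartesianProductWith triE (allFin t) (allFin 3) ++ cartesianProductWith hexE (allFin h) (allFin 6)

  vertices-complete : ∀ v → v ∈ vertices
  vertices-complete centre    = here refl
  vertices-complete (tri i c) = there (∈-++⁺ˡ (∈-cartesianProductWith⁺ tri (∈-allFin i) (∈-allFin c)))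
  vertices-complete (hex j c) = there (∈-++⁺ʳ (cartesianProductWith tri (allFin t) (allFin 2))
    (∈-cartesianProductWith⁺ hex (∈-allFin j) (∈-allFin c)))

  edges-complete : ∀ e → e ∈ edges
  edges-complete (triE i c) = ∈-++⁺ˡ (∈-cartesianProductWith⁺ triE (∈-allFin i) (∈-allFin c))
  edges-complete (hexE j c) = ∈-++⁺ʳ (cartesianProductWith triE (allFin t) (allFin 3))
    (∈-cartesianProductWith⁺ hexE (∈-allFin j) (∈-allFin c))

  length-vertices : length vertices ≡ 1 + 2 * t + 5 * h
  length-vertices = cong suc (trans (length-++ (cartesianProductWith tri (allFin t) (allFin 2)))
    (cong₂ _+_ (trans (length-grid t 2 tri) (*-comm t 2)) (trans (length-grid h 5 hex) (*-comm h 5))))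

  length-edges : length edges ≡ edgesC3tC6h t h
  length-edges = trans (length-++ (cartesianProductWith triE (allFin t) (allFin 3)))
    (cong₂ _+_ (trans (length-grid t 3 triE) (*-comm t 3)) (trans (length-grid h 6 hexE) (*-comm h 6)))

module _ (T : List Triangle) (H : List Hexagon) where

  private
    t = length T
    h = length H
    G = C3tC6h t h
    m = edgesC3tC6h t h

  labelling : CVertex t h → ℕ
  labelling centre                                    = 0
  labelling (tri i zero)                              = proj₁ (lookup T i)
  labelling (tri i (suc zero))                        = proj₂ (lookup T i)
  labelling (hex j zero)                              = v₁ (lookup H j)
  labelling (hex j (suc zero))                        = v₂ (lookup H j)
  labelling (hex j (suc (suc zero)))                  = v₃ (lookup H j)
  labelling (hex j (suc (suc (suc zero))))            = v₄ (lookup H j)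
  labelling (hex j (suc (suc (suc (suc zero)))))      = v₅ (lookup H j)

  label⇒vertex : ∀ {x} → VertexLabel T H x → ∃[ v ] labelling v ≡ x
  label⇒vertex (inj₁ refl) = centre , refl
  label⇒vertex (inj₂ (inj₁ x∈)) with locate {as = T} x∈
  ... | i , here refl         = tri i zero , refl
  ... | i , there (here refl) = tri i (suc zero) , refl
  label⇒vertex (inj₂ (inj₂ x∈)) with locate {as = H} x∈
  ... | j , here refl                                 = hex j zero , refl
  ... | j , there (here refl)                         = hex j (suc zero) , refl
  ... | j , there (there (here refl))                 = hex j (suc (suc zero)) , refl
  ... | j , there (there (there (here refl)))         = hex j (suc (suc (suc zero))) , refl
  ... | j , there (there (there (there (here refl)))) = hex j (suc (suc (suc (suc zero)))) , refl

  label⇒edge : ∀ {x} → EdgeLabel T H x → ∃[ e ] edgeLabel G labelling e ≡ x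
  label⇒edge (inj₁ x∈) with locate {as = T} x∈
  ... | i , here refl                 = triE i zero , refl
  ... | i , there (here refl)         = triE i (suc zero) , refl
  ... | i , there (there (here refl)) = triE i (suc (suc zero)) , ∣-∣-identityʳ _
  label⇒edge (inj₂ x∈) with locate {as = H} x∈
  ... | j , here refl                                         = hexE j zero , refl
  ... | j , there (here refl)                                 = hexE j (suc zero) , refl
  ... | j , there (there (here refl))                         = hexE j (suc (suc zero)) , refl
  ... | j , there (there (there (here refl)))                 = hexE j (suc (suc (suc zero))) , refl
  ... | j , there (there (there (there (here refl))))         = hexE j (suc (suc (suc (suc zero)))) , refl
  ... | j , there (there (there (there (there (here refl))))) =
    hexE j (suc (suc (suc (suc (suc zero))))) , ∣-∣-identityʳ _

  -- The runs are as long as there are vertices and edges, so by pigeonhole no other label occurs.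
  -- This gives injectivity, the bound on the vertex labels and, because `Target` is carried along
  -- the edge run, that every edge label lies in `Target`.
  runs⇒labelledOnto : ∀ {bound Target lo hi} →
    Run (VertexLabel T H) 0 (suc bound) (1 + 2 * t + 5 * h) →
    Run (λ x → EdgeLabel T H x × Target x) lo hi m →
    (∀ x → Target x → EdgeLabel T H x) →
    LabelledOnto G bound Target labelling
  runs⇒labelledOnto {Target = Target} vs es onto =
      (λ v → ≤-pred (All.lookup (values-< vs) (exhausted⇒∈ _ (vertices-complete t h) labelling (values-unique vs) hitV lenV v)))
    , exhausted⇒injective _ (vertices-complete t h) labelling (values-unique vs) hitV lenV
    , (λ e → proj₂ (All.lookup (values-satisfy es) (exhausted⇒∈ _ (edges-complete t h) (edgeLabel G labelling) (values-unique es) hitE lenE e)))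
    , exhausted⇒injective _ (edges-complete t h) (edgeLabel G labelling) (values-unique es) hitE lenE
    , λ x tx → label⇒edge (onto x tx)
    where
    hitV : ∀ {x} → x ∈ values vs → ∃[ v ] labelling v ≡ x
    hitV x∈ = label⇒vertex (All.lookup (values-satisfy vs) x∈)
    lenV : length (vertices t h) ≤ length (values vs)
    lenV = ≤-reflexive (trans (length-vertices t h) (sym (values-length vs)))
    hitE : ∀ {x} → x ∈ values es → ∃[ e ] edgeLabel G labelling e ≡ x
    hitE x∈ = label⇒edge (proj₁ (All.lookup (values-satisfy es) x∈))
    lenE : length (edges t h) ≤ length (values es)
    lenE = ≤-reflexive (trans (length-edges t h) (sym (values-length es)))

  blocks⇒graceful : Run (VertexLabel T H) 0 (suc m) (1 + 2 * t + 5 * h) → Block (EdgeLabel T H) 1 m → Graceful G m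
  blocks⇒graceful vs es = labelling , runs⇒labelledOnto vs
    (blockRun (mkBlock λ i i<m → at es i i<m , s≤s z≤n , i<m))
    (λ x (1≤x , x≤m) → block∋ es 1≤x (s≤s x≤m))

  blocks⇒nearGraceful : ∀ {p} → m ≡ suc p → Run (VertexLabel T H) 0 (2 + m) (1 + 2 * t + 5 * h) →
    Block (EdgeLabel T H) 1 p → EdgeLabel T H (suc m) → NearGraceful G m
  -- The rewrite lets `m ∸ 1` in the target compute to `p`. The omitted edge label is always m, with
  -- m + 1 in its place.
  blocks⇒nearGraceful {p} m≡1+p vs es top rewrite m≡1+p = labelling , inj₂ (runs⇒labelledOnto vs
    (subst (Run _ _ _) (trans (+-comm p 1) (sym m≡1+p))
      (blockRun (mkBlock λ i i<p → at es i i<p , inj₁ (s≤s z≤n , i<p)) ▹ single (top , inj₂ refl) after 1 by +-comm 1 _))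
    λ { x (inj₁ (1≤x , x≤p)) → block∋ es 1≤x (s≤s x≤p) ; _ (inj₂ refl) → top })

-- Tools for indexed families

infixl 3 _⟫_
_⟫_ : Block P a n → n ≡ p → Block P a p
b ⟫ refl = b

runTo : Run P lo hi n → hi ≡ b → n ≡ p → Run P lo b p
runTo r refl refl = r

-- For t odd, where the differences 1, ..., t contain one more odd number than even ones.
interleave⁺ : ∀ a → Block (λ x → P (a + (x + x))) 0 (suc n) → Block (λ x → P (suc (a + (x + x)))) 0 n → Block P a (n + n + 1)
interleave⁺ {n = n} a evens odds =
  interleave a (mkBlock λ i i<n → at evens i (m≤n⇒m≤1+n i<n)) odds ▸ single (at evens n ≤-refl)

-- Each entry receives its distance from the front and from the back, the two indices that `block`
-- and `blockᵒ` quantify over.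
enumerate : (ℕ → ℕ → A) → ℕ → List A
enumerate F zero    = []
enumerate F (suc n) = F 0 n ∷ enumerate (F ∘ suc) n

∈-enumerate : (F : ℕ → ℕ → A) → ∀ i j → suc (i + j) ≡ n → F i j ∈ enumerate F n
∈-enumerate F zero    j refl = here refl
∈-enumerate F (suc i) j refl = there (∈-enumerate (F ∘ suc) i j refl)

length-enumerate : (F : ℕ → ℕ → A) → ∀ n → length (enumerate F n) ≡ n
length-enumerate F zero    = refl
length-enumerate F (suc n) = cong suc (length-enumerate (F ∘ suc) n)

length-concatMap : {B : Set} (f : A → List B) (size : A → ℕ) → (∀ a → length (f a) ≡ size a) →
  ∀ as → length (concatMap f as) ≡ sum (map size as)
length-concatMap f size eq []       = refl
length-concatMap f size eq (a ∷ as) = trans (length-++ (f a)) (cong₂ _+_ (eq a) (length-concatMap f size eq as))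

∈-family : {I : Set} (F : I → ℕ → ℕ → A) (size : I → ℕ) {is : List I} {ι : I} → ι ∈ is → ∀ i j → suc (i + j) ≡ size ι →
  F ι i j ∈ concatMap (λ ι → enumerate (F ι) (size ι)) is
∈-family F size ι∈ i j eq = ∈-concatMap⁺ _ (lose ι∈ (∈-enumerate (F _) i j eq))

pattern #0 = here refl
pattern #1 = there #0
pattern #2 = there #1
pattern #3 = there #2
pattern #4 = there #3
pattern #5 = there #4
pattern #6 = there #5
pattern #7 = there #6

-- Nested chords and pairings of Skolem type

Difference : List Triangle → ℕ → Set
Difference T d = Any (λ (x , y) → y ≡ x + d) T

-- The pairs (a + i, a + i + d + 2j) with i + j = n - 1: concentric chords whose lengths are d, d + 2, …, d + 2(n - 1).
record Nest : Set where
  constructor nest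
  field start innermost size : ℕ

chord : Nest → ℕ → ℕ → Triangle
chord (nest a d _) i j = a + i , a + i + (d + (j + j))

chords : List Nest → List Triangle
chords = concatMap λ ν → enumerate (chord ν) (Nest.size ν)

length-chords : ∀ Ns → length (chords Ns) ≡ sum (map Nest.size Ns)
length-chords = length-concatMap _ Nest.size λ ν → length-enumerate (chord ν) (Nest.size ν)

module Chords (Ns : List Nest) {a d n : ℕ} (ν∈ : nest a d n ∈ Ns) where

  left : a ≡ b → Block (TriVertex (chords Ns)) b n
  left refl = block λ i j eq → ∈-concatMap⁺ _ (lose (∈-family chord Nest.size ν∈ i j eq) #0)

  -- The block of right ends begins at that of the innermost chord, a + (n - 1) + d, and moves up by
  -- one with each chord further out.
  right : suc b ≡ a + d + n → Block (TriVertex (chords Ns)) b n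
  right {b} eq = blockᵒ λ i j i+j≡ → ∈-concatMap⁺ _ (lose (∈-family chord Nest.size ν∈ i j i+j≡) (there (here (upper i j i+j≡))))
    where
    upper : ∀ i j → suc (i + j) ≡ n → b + j ≡ a + i + (d + (j + j))
    upper i j refl = trans (cong (_+ j) (suc-injective (trans eq (+-suc (a + d) (i + j))))) (solve (a ∷ d ∷ i ∷ j ∷ []))

  private
    gap : ∀ {x} i → d + (i + i) ≡ x → i < n → Difference (chords Ns) x
    gap i refl i<n = let j , eq = m≤n⇒∃[o]m+o≡n i<n in
      lose (∈-family chord Nest.size ν∈ j i (trans (cong suc (+-comm j i)) eq)) refl

  -- All lengths in a nest have the same parity, so their halves form a block, ready for
  -- `interleave`.
  oddGap : d ≡ suc (b + b) → Block (λ x → Difference (chords Ns) (suc (x + x))) b n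
  oddGap {b} eq .at i = gap i (trans (cong (_+ (i + i)) eq) (solve (b ∷ i ∷ [])))

  evenGap : d ≡ suc (suc (b + b)) → Block (λ x → Difference (chords Ns) (suc (suc (x + x)))) b n
  evenGap {b} eq .at i = gap i (trans (cong (_+ (i + i)) eq) (solve (b ∷ i ∷ [])))

record Pairing (t : ℕ) (Positions : List Triangle → Set) : Set where
  field
    pairs       : List Triangle
    size        : length pairs ≡ t
    differences : Block (Difference pairs) 1 t
    positions   : Positions pairs

open Pairing

-- A Skolem pairing covers 1, …, 2t; a hook moves the last (or the first) position one step outwards.
-- Except for Skolem the argument is t - 1.
Skolem Hooked ReverseHooked DoublyHooked : ℕ → Set
Skolem        t = Pairing t       λ T → Block (TriVertex T) 1 (2 * t)
Hooked        r = Pairing (suc r) λ T → Block (TriVertex T) 1 (2 * r + 1) × Block (TriVertex T) (2 * r + 3) 1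
ReverseHooked r = Pairing (suc r) λ T → Block (TriVertex T) 1 1 × Block (TriVertex T) 3 (2 * r + 1)
DoublyHooked  r = Pairing (suc r) λ T → Block (TriVertex T) 1 1 × Block (TriVertex T) 3 (2 * r) × Block (TriVertex T) (2 * r + 4) 1

-- Hexagon families and the labels they cover

-- The hexagons (y₁ + i, x₂ + 2i, y₃ + i, x₄ + 2i, y₅ + i) with i < k: each of the six edges runs through k consecutive labels.
record Family : Set where
  constructor family
  field y₁ x₂ y₃ x₄ y₅ size : ℕ

member : Family → ℕ → ℕ → Hexagon
member (family y₁ x₂ y₃ x₄ y₅ _) i _ = hexagon (y₁ + i) (x₂ + (i + i)) (y₃ + i) (x₄ + (i + i)) (y₅ + i)

hexagons : List Family → List Hexagon
hexagons = concatMap λ φ → enumerate (member φ) (Family.size φ)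

length-hexagons : ∀ Φ → length (hexagons Φ) ≡ sum (map Family.size Φ)
length-hexagons = length-concatMap _ Family.size λ φ → length-enumerate (member φ) (Family.size φ)

module Hexagons (Φ : List Family) {y₁ x₂ y₃ x₄ y₅ k : ℕ} (φ∈ : family y₁ x₂ y₃ x₄ y₅ k ∈ Φ) where

  private
    vertexOf : ∀ {x} i j → suc (i + j) ≡ k → x ∈ hexVertices (member (family y₁ x₂ y₃ x₄ y₅ k) i j) → HexVertex (hexagons Φ) x
    vertexOf i j eq x∈ = ∈-concatMap⁺ _ (lose (∈-family member Family.size φ∈ i j eq) x∈)

    edgeOf : ∀ {x} i j → suc (i + j) ≡ k → x ∈ hexEdges (member (family y₁ x₂ y₃ x₄ y₅ k) i j) → HexEdge (hexagons Φ) x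
    edgeOf i j eq x∈ = ∈-concatMap⁺ _ (lose (∈-family member Family.size φ∈ i j eq) x∈)

    -- The large vertex gains 1 and the small one gains 2, so the label falls by 1 from each hexagon
    -- to the next: from b + k - 1 at i = 0 down to b.
    climb : ∀ {x y} i j → suc (i + j) ≡ k → suc y ≡ b + k + x → b + j ≡ ∣ x + (i + i) - y + i ∣
    climb {b} {x} {y} i j refl eq = sym (trans (cong ∣ x + (i + i) -_∣ up) (∣m-m+n∣≡n (x + (i + i)) (b + j)))
      where
      up : y + i ≡ x + (i + i) + (b + j)
      up = trans (cong (_+ i) (suc-injective (trans eq (cong (_+ x) (+-suc b (i + j)))))) (solve (b ∷ x ∷ i ∷ j ∷ []))

    descend : ∀ {x y} i j → suc (i + j) ≡ k → suc y ≡ b + k + x → b + j ≡ ∣ y + i - x + (i + i) ∣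
    descend {x = x} {y} i j i+j≡ eq = trans (climb i j i+j≡ eq) (∣-∣-comm (x + (i + i)) (y + i))

  high₁ : y₁ ≡ b → Block (HexVertex (hexagons Φ)) b k
  high₁ refl = block λ i j eq → vertexOf i j eq #0

  high₃ : y₃ ≡ b → Block (HexVertex (hexagons Φ)) b k
  high₃ refl = block λ i j eq → vertexOf i j eq #2

  high₅ : y₅ ≡ b → Block (HexVertex (hexagons Φ)) b k
  high₅ refl = block λ i j eq → vertexOf i j eq #4

  low₂ : ∀ b → x₂ ≡ b → Block (λ x → HexVertex (hexagons Φ) (b + (x + x))) 0 k
  low₂ _ refl = block λ i j eq → vertexOf i j eq #1

  low₄ : ∀ b → x₄ ≡ b → Block (λ x → HexVertex (hexagons Φ) (b + (x + x))) 0 k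
  low₄ _ refl = block λ i j eq → vertexOf i j eq #3

  -- A family of size 1 contributes a lone small vertex, which is placed directly and not by
  -- interleaving.
  low₂¹ : k ≡ 1 → x₂ ≡ b → Block (HexVertex (hexagons Φ)) b 1
  low₂¹ refl refl = single (subst (HexVertex (hexagons Φ)) (+-identityʳ x₂) (vertexOf 0 0 refl #1))

  low₄¹ : k ≡ 1 → x₄ ≡ b → Block (HexVertex (hexagons Φ)) b 1
  low₄¹ refl refl = single (subst (HexVertex (hexagons Φ)) (+-identityʳ x₄) (vertexOf 0 0 refl #3))

  edge₁ : y₁ ≡ b → Block (HexEdge (hexagons Φ)) b k
  edge₁ refl = block λ i j eq → edgeOf i j eq #0

  edge₂ : suc y₁ ≡ b + k + x₂ → Block (HexEdge (hexagons Φ)) b k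
  edge₂ y₁≡ = blockᵒ λ i j eq → edgeOf i j eq (there (here (descend i j eq y₁≡)))

  edge₃ : suc y₃ ≡ b + k + x₂ → Block (HexEdge (hexagons Φ)) b k
  edge₃ y₃≡ = blockᵒ λ i j eq → edgeOf i j eq (there (there (here (climb i j eq y₃≡))))

  edge₄ : suc y₃ ≡ b + k + x₄ → Block (HexEdge (hexagons Φ)) b k
  edge₄ y₃≡ = blockᵒ λ i j eq → edgeOf i j eq (there (there (there (here (descend i j eq y₃≡)))))

  edge₅ : suc y₅ ≡ b + k + x₄ → Block (HexEdge (hexagons Φ)) b k
  edge₅ y₅≡ = blockᵒ λ i j eq → edgeOf i j eq (there (there (there (there (here (climb i j eq y₅≡))))))

  edge₆ : y₅ ≡ b → Block (HexEdge (hexagons Φ)) b k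
  edge₆ refl = block λ i j eq → edgeOf i j eq #5

-- The constants are chosen so that the label intervals of the two long families tile all of the labels but
-- six (twelve for evenFamilies), which are the edge labels of the remaining hexagons.
oddFamilies : ℕ → ℕ → List Family
oddFamilies t k =
      family (t + (8 * k + 6)) 2 (t + (6 * k + 5)) (2 * k + 3) (t + (4 * k + 4)) k
    ∷ family (t + (11 * k + 6)) 1 (t + (3 * k + 3)) (2 * k + 2) (t + (9 * k + 6)) k
    ∷ family (t + (12 * k + 7)) (4 * k + 2) (t + (4 * k + 3)) (2 * k + 1) (t + (6 * k + 4)) 1
    ∷ []

-- Of the 18 edge classes only the first edge of the third family is left out. Its label t + 12k + 7
-- lies beyond t + 12k + 6, the label reserved for a triangle.
oddHexagons-edges : ∀ t k → Block (HexEdge (hexagons (oddFamilies t k))) (suc t) (12 * k + 5)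
oddHexagons-edges t k =
  ( edge₃ #2 (solve (t ∷ k ∷ []))
    ▸ edge₄ #1 (solve (t ∷ k ∷ []))
    ▸ edge₅ #0 (solve (t ∷ k ∷ []))
    ▸ edge₄ #2 (solve (t ∷ k ∷ []))
    ▸ edge₃ #1 (solve (t ∷ k ∷ []))
    ▸ edge₄ #0 (solve (t ∷ k ∷ []))
    ▸ edge₅ #2 (solve (t ∷ k ∷ []))
    ▸ edge₆ #0 (solve (t ∷ k ∷ []))
    ▸ edge₃ #0 (solve (t ∷ k ∷ []))
    ▸ edge₆ #2 (solve (t ∷ k ∷ []))
    ▸ edge₅ #1 (solve (t ∷ k ∷ []))
    ▸ edge₂ #0 (solve (t ∷ k ∷ []))
    ▸ edge₂ #2 (solve (t ∷ k ∷ []))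
    ▸ edge₁ #0 (solve (t ∷ k ∷ []))
    ▸ edge₆ #1 (solve (t ∷ k ∷ []))
    ▸ edge₂ #1 (solve (t ∷ k ∷ []))
    ▸ edge₁ #1 (solve (t ∷ k ∷ []))
  ) ⟫ solve (k ∷ [])
  where open Hexagons (oddFamilies t k)

oddHexagons-lows : ∀ t k → Block (HexVertex (hexagons (oddFamilies t k))) 1 (4 * k + 2)
oddHexagons-lows t k =
  ( interleave {n = k} 1 (low₂ #1 1 refl) (low₂ #0 2 refl)
    ▸ low₄¹ #2 refl (solve (k ∷ []))
    ▸ interleave {n = k} (1 + (k + k + 1)) (low₄ #1 (1 + (k + k + 1)) (solve (k ∷ []))) (low₄ #0 (2 + (k + k + 1)) (solve (k ∷ [])))
    ▸ low₂¹ #2 refl (solve (k ∷ []))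
  ) ⟫ solve (k ∷ [])
  where open Hexagons (oddFamilies t k)

oddHexagons-vertices : ∀ t k τ → t ≡ k + τ → Run (HexVertex (hexagons (oddFamilies t k))) 1 (t + (12 * k + 6)) (10 * k + 4)
oddHexagons-vertices t k τ t≡ =
  runTo
  ( blockRun (oddHexagons-lows t k)
    -- The small vertices end at 4k + 2 and the large ones start at t + 3k + 3. They stay apart
    -- because k ≤ t, and `τ` is the gap.
    ▹ high₃ #1 refl after τ by gap
    ▹ high₃ #2 refl after 0 by solve (t ∷ k ∷ [])
    ▹ high₅ #0 refl after 0 by solve (t ∷ k ∷ [])
    ▹ high₅ #2 refl after k by solve (t ∷ k ∷ [])
    ▹ high₃ #0 refl after 0 by solve (t ∷ k ∷ [])
    ▹ high₁ #0 refl after (k + 1) by solve (t ∷ k ∷ [])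
    ▹ high₅ #1 refl after 0 by solve (t ∷ k ∷ [])
    ▹ high₁ #1 refl after k by solve (t ∷ k ∷ [])
  ) (solve (t ∷ k ∷ [])) (solve (k ∷ []))
  where
  open Hexagons (oddFamilies t k)
  gap : t + (3 * k + 3) ≡ 1 + (4 * k + 2) + τ
  gap = trans (cong (_+ (3 * k + 3)) t≡) (solve (k ∷ τ ∷ []))

evenFamilies : ℕ → ℕ → List Family
evenFamilies t k =
      family (t + (7 * k + 8)) 2 (t + (3 * k + 4)) (2 * k + 4) (t + (4 * k + 4)) k
    ∷ family (t + (10 * k + 11)) 1 (t + (6 * k + 6)) (2 * k + 3) (t + (11 * k + 12)) k
    ∷ family (t + (12 * k + 12)) (4 * k + 3) (t + (6 * k + 5)) (4 * k + 4) (t + (7 * k + 7)) 1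
    ∷ family (t + (11 * k + 11)) (2 * k + 1) (t + (7 * k + 6)) (2 * k + 2) (t + (8 * k + 8)) 1
    ∷ []

evenHexagons-edges : ∀ t k → Block (HexEdge (hexagons (evenFamilies t k))) (suc t) (12 * k + 12)
evenHexagons-edges t k =
  ( edge₄ #0 (solve (t ∷ k ∷ []))
    ▸ edge₅ #0 (solve (t ∷ k ∷ []))
    ▸ edge₄ #2 (solve (t ∷ k ∷ []))
    ▸ edge₃ #2 (solve (t ∷ k ∷ []))
    ▸ edge₃ #0 (solve (t ∷ k ∷ []))
    ▸ edge₅ #2 (solve (t ∷ k ∷ []))
    ▸ edge₄ #1 (solve (t ∷ k ∷ []))
    ▸ edge₆ #0 (solve (t ∷ k ∷ []))
    ▸ edge₄ #3 (solve (t ∷ k ∷ []))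
    ▸ edge₃ #3 (solve (t ∷ k ∷ []))
    ▸ edge₃ #1 (solve (t ∷ k ∷ []))
    ▸ edge₅ #3 (solve (t ∷ k ∷ []))
    ▸ edge₂ #0 (solve (t ∷ k ∷ []))
    ▸ edge₆ #2 (solve (t ∷ k ∷ []))
    ▸ edge₁ #0 (solve (t ∷ k ∷ []))
    ▸ edge₆ #3 (solve (t ∷ k ∷ []))
    ▸ edge₂ #2 (solve (t ∷ k ∷ []))
    ▸ edge₅ #1 (solve (t ∷ k ∷ []))
    ▸ edge₂ #3 (solve (t ∷ k ∷ []))
    ▸ edge₂ #1 (solve (t ∷ k ∷ []))
    ▸ edge₁ #1 (solve (t ∷ k ∷ []))
    ▸ edge₁ #3 (solve (t ∷ k ∷ []))
    ▸ edge₆ #1 (solve (t ∷ k ∷ []))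
    ▸ edge₁ #2 (solve (t ∷ k ∷ []))
  ) ⟫ solve (k ∷ [])
  where open Hexagons (evenFamilies t k)

evenHexagons-lows : ∀ t k → Block (HexVertex (hexagons (evenFamilies t k))) 1 (4 * k + 4)
evenHexagons-lows t k =
  ( interleave {n = k} 1 (low₂ #1 1 refl) (low₂ #0 2 refl)
    ▸ low₂¹ #3 refl (solve (k ∷ [])) ▸ low₄¹ #3 refl (solve (k ∷ []))
    ▸ interleave {n = k} (1 + (k + k + 1 + 1)) (low₄ #1 (1 + (k + k + 1 + 1)) (solve (k ∷ []))) (low₄ #0 (2 + (k + k + 1 + 1)) (solve (k ∷ [])))
    ▸ low₂¹ #2 refl (solve (k ∷ [])) ▸ low₄¹ #2 refl (solve (k ∷ []))
  ) ⟫ solve (k ∷ [])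
  where open Hexagons (evenFamilies t k)

evenHexagons-vertices : ∀ t k τ → t ≡ suc k + τ → Run (HexVertex (hexagons (evenFamilies t k))) 1 (t + (12 * k + 13)) (10 * k + 10)
evenHexagons-vertices t k τ t≡ =
  runTo
  ( blockRun (evenHexagons-lows t k)
    -- Here the small vertices end at 4k + 4 and the large ones start at t + 3k + 4, whence the
    -- requirement k + 1 ≤ t.
    ▹ high₃ #0 refl after τ by gap
    ▹ high₅ #0 refl after 0 by solve (t ∷ k ∷ [])
    ▹ high₃ #2 refl after (k + 1) by solve (t ∷ k ∷ [])
    ▹ high₃ #1 refl after 0 by solve (t ∷ k ∷ [])
    ▹ high₃ #3 refl after 0 by solve (t ∷ k ∷ [])
    ▹ high₅ #2 refl after 0 by solve (t ∷ k ∷ [])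
    ▹ high₁ #0 refl after 0 by solve (t ∷ k ∷ [])
    ▹ high₅ #3 refl after 0 by solve (t ∷ k ∷ [])
    ▹ high₁ #1 refl after (2 * k + 2) by solve (t ∷ k ∷ [])
    ▹ high₁ #3 refl after 0 by solve (t ∷ k ∷ [])
    ▹ high₅ #1 refl after 0 by solve (t ∷ k ∷ [])
    ▹ high₁ #2 refl after 0 by solve (t ∷ k ∷ [])
  ) (solve (t ∷ k ∷ [])) (solve (k ∷ []))
  where
  open Hexagons (evenFamilies t k)
  gap : t + (3 * k + 4) ≡ 1 + (4 * k + 4) + τ
  gap = trans (cong (_+ (3 * k + 4)) t≡) (solve (k ∷ τ ∷ []))

-- Explicit pairings in each residue class modulo 4

-- The first nest occupies the left half and carries the odd lengths from 3 on; the two positions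
-- inside its innermost chord hold left ends of single pairs. On the right, one nest of size `u`
-- encloses the other, and they carry the even lengths above and below 2u + 2. Single pairs supply
-- 1, 2u + 2 and 4u + 4. The later pairings vary this pattern.
skolem₀ : ∀ u → Skolem (4 + u * 4)
skolem₀ u = record
  { pairs = chords nests
  ; size = trans (length-chords nests) total
  ; differences = interleave {n = 2 * u + 2} 1
      (( oddGap #5 (solve (u ∷ []))
        ▸ oddGap #0 (solve (u ∷ []))
       ) ⟫ solve (u ∷ []))
      (( evenGap #2 (solve (u ∷ []))
        ▸ evenGap #4 (solve (u ∷ []))
        ▸ evenGap #1 (solve (u ∷ []))
        ▸ evenGap #3 (solve (u ∷ []))
       ) ⟫ solve (u ∷ []))
      ⟫ solve (u ∷ [])
  ; positions =
      ( left #0 (solve (u ∷ []))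
      ▸ left #3 (solve (u ∷ []))
      ▸ left #4 (solve (u ∷ []))
      ▸ right #0 (solve (u ∷ []))
      ▸ right #4 (solve (u ∷ []))
      ▸ left #1 (solve (u ∷ []))
      ▸ left #2 (solve (u ∷ []))
      ▸ right #3 (solve (u ∷ []))
      ▸ right #2 (solve (u ∷ []))
      ▸ left #5 (solve (u ∷ []))
      ▸ right #5 (solve (u ∷ []))
      ▸ right #1 (solve (u ∷ []))
      ) ⟫ solve (u ∷ [])
  }
  where
  nests : List Nest
  nests =
      nest 1 3 (2 * u + 1)
    ∷ nest (4 * u + 6) (2 * u + 4) u
    ∷ nest (5 * u + 6) 2 u
    ∷ nest (2 * u + 2) (4 * u + 4) 1
    ∷ nest (2 * u + 3) (2 * u + 2) 1
    ∷ nest (7 * u + 7) 1 1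
    ∷ []
  open Chords nests
  total : (2 * u + 1) + (u + (u + (1 + (1 + (1 + 0))))) ≡ 4 + u * 4
  total = solve (u ∷ [])

-- The parities change places: the large nest has even lengths, the two nests on the right odd ones.
skolem₁ : ∀ u → Skolem (5 + u * 4)
skolem₁ u = record
  { pairs = chords nests
  ; size = trans (length-chords nests) total
  ; differences = interleave⁺ {n = 2 * u + 2} 1
      (( oddGap #5 (solve (u ∷ []))
        ▸ oddGap #2 (solve (u ∷ []))
        ▸ oddGap #4 (solve (u ∷ []))
        ▸ oddGap #1 (solve (u ∷ []))
       ) ⟫ solve (u ∷ []))
      (( evenGap #0 (solve (u ∷ []))
        ▸ evenGap #3 (solve (u ∷ []))
       ) ⟫ solve (u ∷ []))
      ⟫ solve (u ∷ [])
  ; positions =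
      ( left #0 (solve (u ∷ []))
      ▸ left #3 (solve (u ∷ []))
      ▸ right #0 (solve (u ∷ []))
      ▸ left #1 (solve (u ∷ []))
      ▸ left #2 (solve (u ∷ []))
      ▸ left #4 (solve (u ∷ []))
      ▸ right #3 (solve (u ∷ []))
      ▸ right #2 (solve (u ∷ []))
      ▸ left #5 (solve (u ∷ []))
      ▸ right #5 (solve (u ∷ []))
      ▸ right #1 (solve (u ∷ []))
      ▸ right #4 (solve (u ∷ []))
      ) ⟫ solve (u ∷ [])
  }
  where
  nests : List Nest
  nests =
      nest 1 2 (2 * u + 1)
    ∷ nest (4 * u + 4) (2 * u + 7) u
    ∷ nest (5 * u + 4) 3 (u + 1)
    ∷ nest (2 * u + 2) (4 * u + 4) 1
    ∷ nest (6 * u + 5) (2 * u + 5) 1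
    ∷ nest (7 * u + 8) 1 1
    ∷ []
  open Chords nests
  total : (2 * u + 1) + (u + ((u + 1) + (1 + (1 + (1 + 0))))) ≡ 5 + u * 4
  total = solve (u ∷ [])

-- The hook 2t + 1 is the right end of the longest pair, of length t.
hooked₂ : ∀ u → Hooked (5 + u * 4)
hooked₂ u = record
  { pairs = chords nests
  ; size = trans (length-chords nests) total
  ; differences = interleave {n = 2 * u + 3} 1
      (( oddGap #6 (solve (u ∷ []))
        ▸ oddGap #2 (solve (u ∷ []))
        ▸ oddGap #4 (solve (u ∷ []))
        ▸ oddGap #1 (solve (u ∷ []))
        ▸ oddGap #3 (solve (u ∷ []))
       ) ⟫ solve (u ∷ []))
      (( evenGap #0 (solve (u ∷ []))
        ▸ evenGap #5 (solve (u ∷ []))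
       ) ⟫ solve (u ∷ []))
      ⟫ solve (u ∷ [])
  ; positions =
      (( left #0 (solve (u ∷ []))
       ▸ left #3 (solve (u ∷ []))
       ▸ right #0 (solve (u ∷ []))
       ▸ left #4 (solve (u ∷ []))
       ▸ left #5 (solve (u ∷ []))
       ▸ left #1 (solve (u ∷ []))
       ▸ left #2 (solve (u ∷ []))
       ▸ right #3 (solve (u ∷ []))
       ▸ right #4 (solve (u ∷ []))
       ▸ right #2 (solve (u ∷ []))
       ▸ left #6 (solve (u ∷ []))
       ▸ right #6 (solve (u ∷ []))
       ▸ right #1 (solve (u ∷ []))
      ) ⟫ solve (u ∷ []))
      , right #5 (solve (u ∷ []))
  }
  where
  nests : List Nest
  nests =
      nest 1 2 (2 * u + 2)
    ∷ nest (4 * u + 8) (2 * u + 5) u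
    ∷ nest (5 * u + 8) 3 u
    ∷ nest (2 * u + 3) (4 * u + 5) 1
    ∷ nest (4 * u + 6) (2 * u + 3) 1
    ∷ nest (4 * u + 7) (4 * u + 6) 1
    ∷ nest (7 * u + 10) 1 1
    ∷ []
  open Chords nests
  total : (2 * u + 2) + (u + (u + (1 + (1 + (1 + (1 + 0)))))) ≡ 6 + u * 4
  total = solve (u ∷ [])

-- The hook comes from the pair (2t - 1, 2t + 1), which straddles the hole at 2t and supplies the
-- length 2.
hooked₃ : ∀ u → Hooked (6 + u * 4)
hooked₃ u = record
  { pairs = chords nests
  ; size = trans (length-chords nests) total
  ; differences = interleave⁺ {n = 2 * u + 3} 1
      (( oddGap #7 (solve (u ∷ []))
        ▸ oddGap #2 (solve (u ∷ []))
        ▸ oddGap #5 (solve (u ∷ []))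
        ▸ oddGap #1 (solve (u ∷ []))
        ▸ oddGap #4 (solve (u ∷ []))
        ▸ oddGap #3 (solve (u ∷ []))
       ) ⟫ solve (u ∷ []))
      (( evenGap #6 (solve (u ∷ []))
        ▸ evenGap #0 (solve (u ∷ []))
       ) ⟫ solve (u ∷ []))
      ⟫ solve (u ∷ [])
  ; positions =
      (( left #0 (solve (u ∷ []))
       ▸ left #3 (solve (u ∷ []))
       ▸ left #4 (solve (u ∷ []))
       ▸ left #5 (solve (u ∷ []))
       ▸ right #0 (solve (u ∷ []))
       ▸ right #5 (solve (u ∷ []))
       ▸ left #1 (solve (u ∷ []))
       ▸ left #2 (solve (u ∷ []))
       ▸ right #4 (solve (u ∷ []))
       ▸ right #3 (solve (u ∷ []))
       ▸ right #2 (solve (u ∷ []))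
       ▸ left #7 (solve (u ∷ []))
       ▸ right #7 (solve (u ∷ []))
       ▸ right #1 (solve (u ∷ []))
       ▸ left #6 (solve (u ∷ []))
      ) ⟫ solve (u ∷ []))
      , right #6 (solve (u ∷ []))
  }
  where
  nests : List Nest
  nests =
      nest 1 4 (2 * u + 2)
    ∷ nest (4 * u + 9) (2 * u + 5) u
    ∷ nest (5 * u + 9) 3 u
    ∷ nest (2 * u + 3) (4 * u + 7) 1
    ∷ nest (2 * u + 4) (4 * u + 5) 1
    ∷ nest (2 * u + 5) (2 * u + 3) 1
    ∷ nest (8 * u + 13) 2 1
    ∷ nest (7 * u + 11) 1 1
    ∷ []
  open Chords nests
  total : (2 * u + 2) + (u + (u + (1 + (1 + (1 + (1 + (1 + 0))))))) ≡ 7 + u * 4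
  total = solve (u ∷ [])

-- The isolated position 1 belongs to the pair of length 2u + 4, whose right end lies inside the
-- first nest. The longest pair reaches the hook 2t + 2.
doublyHooked₀ : ∀ u → DoublyHooked (7 + u * 4)
doublyHooked₀ u = record
  { pairs = chords nests
  ; size = trans (length-chords nests) total
  ; differences = interleave {n = 2 * u + 4} 1
      (( oddGap #7 (solve (u ∷ []))
        ▸ oddGap #0 (solve (u ∷ []))
        ▸ oddGap #4 (solve (u ∷ []))
       ) ⟫ solve (u ∷ []))
      (( evenGap #2 (solve (u ∷ []))
        ▸ evenGap #6 (solve (u ∷ []))
        ▸ evenGap #1 (solve (u ∷ []))
        ▸ evenGap #5 (solve (u ∷ []))
        ▸ evenGap #3 (solve (u ∷ []))
       ) ⟫ solve (u ∷ []))
      ⟫ solve (u ∷ [])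
  ; positions =
      left #6 (solve (u ∷ []))
      , (( left #0 (solve (u ∷ []))
         ▸ right #6 (solve (u ∷ []))
         ▸ left #5 (solve (u ∷ []))
         ▸ right #0 (solve (u ∷ []))
         ▸ left #4 (solve (u ∷ []))
         ▸ left #3 (solve (u ∷ []))
         ▸ left #1 (solve (u ∷ []))
         ▸ left #2 (solve (u ∷ []))
         ▸ right #5 (solve (u ∷ []))
         ▸ right #2 (solve (u ∷ []))
         ▸ left #7 (solve (u ∷ []))
         ▸ right #7 (solve (u ∷ []))
         ▸ right #1 (solve (u ∷ []))
         ▸ right #4 (solve (u ∷ []))
        ) ⟫ solve (u ∷ []))
      , right #3 (solve (u ∷ []))
  }
  where
  nests : List Nest
  nests =
      nest 3 3 (2 * u + 2)
    ∷ nest (4 * u + 11) (2 * u + 6) u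
    ∷ nest (5 * u + 11) 2 (u + 1)
    ∷ nest (4 * u + 10) (4 * u + 8) 1
    ∷ nest (4 * u + 9) (4 * u + 7) 1
    ∷ nest (2 * u + 6) (4 * u + 6) 1
    ∷ nest 1 (2 * u + 4) 1
    ∷ nest (7 * u + 14) 1 1
    ∷ []
  open Chords nests
  total : (2 * u + 2) + (u + ((u + 1) + (1 + (1 + (1 + (1 + (1 + 0))))))) ≡ 8 + u * 4
  total = solve (u ∷ [])

-- Position 1 belongs to the pair of length 2u + 3, and the pair (2t, 2t + 2) of length 2 straddles
-- the upper hole.
doublyHooked₁ : ∀ u → DoublyHooked (4 + u * 4)
doublyHooked₁ u = record
  { pairs = chords nests
  ; size = trans (length-chords nests) total
  ; differences = interleave⁺ {n = 2 * u + 2} 1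
      (( oddGap #7 (solve (u ∷ []))
        ▸ oddGap #2 (solve (u ∷ []))
        ▸ oddGap #5 (solve (u ∷ []))
        ▸ oddGap #1 (solve (u ∷ []))
        ▸ oddGap #3 (solve (u ∷ []))
       ) ⟫ solve (u ∷ []))
      (( evenGap #6 (solve (u ∷ []))
        ▸ evenGap #0 (solve (u ∷ []))
        ▸ evenGap #4 (solve (u ∷ []))
       ) ⟫ solve (u ∷ []))
      ⟫ solve (u ∷ [])
  ; positions =
      left #5 (solve (u ∷ []))
      , (( left #0 (solve (u ∷ []))
         ▸ left #3 (solve (u ∷ []))
         ▸ right #5 (solve (u ∷ []))
         ▸ left #4 (solve (u ∷ []))
         ▸ right #0 (solve (u ∷ []))
         ▸ left #1 (solve (u ∷ []))
         ▸ left #7 (solve (u ∷ []))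
         ▸ right #7 (solve (u ∷ []))
         ▸ left #2 (solve (u ∷ []))
         ▸ right #3 (solve (u ∷ []))
         ▸ right #4 (solve (u ∷ []))
         ▸ right #2 (solve (u ∷ []))
         ▸ right #1 (solve (u ∷ []))
         ▸ left #6 (solve (u ∷ []))
        ) ⟫ solve (u ∷ []))
      , right #6 (solve (u ∷ []))
  }
  where
  nests : List Nest
  nests =
      nest 3 4 (2 * u)
    ∷ nest (4 * u + 6) (2 * u + 5) u
    ∷ nest (5 * u + 8) 3 u
    ∷ nest (2 * u + 3) (4 * u + 5) 1
    ∷ nest (2 * u + 5) (4 * u + 4) 1
    ∷ nest 1 (2 * u + 3) 1
    ∷ nest (8 * u + 10) 2 1
    ∷ nest (5 * u + 6) 1 1
    ∷ []
  open Chords nests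
  total : (2 * u) + (u + (u + (1 + (1 + (1 + (1 + (1 + 0))))))) ≡ 5 + u * 4
  total = solve (u ∷ [])

-- Small pairings, checked by decision procedures

block? : Decidable P → ∀ a n → Dec (Block P a n)
block? P? a n with allUpTo? (P? ∘ (a +_)) n
... | yes p = yes (mkBlock λ _ → p)
... | no ¬p = no λ b → ¬p (at b _)

triVertex? : ∀ T → Decidable (TriVertex T)
triVertex? T x = member? _≟_ x (concatMap triVertices T)

difference? : ∀ T → Decidable (Difference T)
difference? T d = any? (λ (x , y) → y ≟ x + d) T

vertexLabel? : ∀ T H → Decidable (VertexLabel T H)
vertexLabel? T H x = x ≟ 0 ⊎-dec triVertex? T x ⊎-dec member? _≟_ x (concatMap hexVertices H)

edgeLabel? : ∀ T H → Decidable (EdgeLabel T H)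
edgeLabel? T H x = member? _≟_ x (concatMap triEdges T) ⊎-dec member? _≟_ x (concatMap hexEdges H)

skolem-1 : Skolem 1
skolem-1 = record
  { pairs = T ; size = refl
  ; differences = from-yes (block? (difference? T) 1 1)
  ; positions = from-yes (block? (triVertex? T) 1 2)
  }
  where
  T = (1 , 2) ∷ []

hooked-2 : Hooked 1
hooked-2 = record
  { pairs = T ; size = refl
  ; differences = from-yes (block? (difference? T) 1 2)
  ; positions = from-yes (block? (triVertex? T) 1 3) , from-yes (block? (triVertex? T) 5 1)
  }
  where
  T = (1 , 2) ∷ (3 , 5) ∷ []

hooked-3 : Hooked 2
hooked-3 = record
  { pairs = T ; size = refl
  ; differences = from-yes (block? (difference? T) 1 3)
  ; positions = from-yes (block? (triVertex? T) 1 5) , from-yes (block? (triVertex? T) 7 1)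
  }
  where
  T = (1 , 4) ∷ (2 , 3) ∷ (5 , 7) ∷ []

doublyHooked-4 : DoublyHooked 3
doublyHooked-4 = record
  { pairs = T ; size = refl
  ; differences = from-yes (block? (difference? T) 1 4)
  ; positions = from-yes (block? (triVertex? T) 1 1) , from-yes (block? (triVertex? T) 3 6) , from-yes (block? (triVertex? T) 10 1)
  }
  where
  T = (3 , 4) ∷ (6 , 8) ∷ (7 , 10) ∷ (1 , 5) ∷ []

-- Choice of the pairing by residue

data Mod4 : ℕ → Set where
  0+4 : ∀ u → Mod4 (u * 4)
  1+4 : ∀ u → Mod4 (1 + u * 4)
  2+4 : ∀ u → Mod4 (2 + u * 4)
  3+4 : ∀ u → Mod4 (3 + u * 4)

mod4 : ∀ n → Mod4 n
mod4 zero = 0+4 0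
mod4 (suc n) with mod4 n
... | 0+4 u = 1+4 u
... | 1+4 u = 2+4 u
... | 2+4 u = 3+4 u
... | 3+4 u = 0+4 (suc u)

-- Since t = r + 1, the Skolem cases t ≡ 0, 1 appear as r ≡ 3, 0.
skolem⊎hooked : ∀ r → Skolem (suc r) ⊎ Hooked r
skolem⊎hooked r with mod4 r
... | 0+4 zero    = inj₁ skolem-1
... | 0+4 (suc u) = inj₁ (skolem₁ u)
... | 1+4 zero    = inj₂ hooked-2
... | 1+4 (suc u) = inj₂ (hooked₂ u)
... | 2+4 zero    = inj₂ hooked-3
... | 2+4 (suc u) = inj₂ (hooked₃ u)
... | 3+4 u       = inj₁ (skolem₀ u)

-- Here t = r + 2, which excludes t = 1; the doubly hooked cases t ≡ 0, 1 appear as r ≡ 2, 3.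
doublyHooked⊎hooked : ∀ r → DoublyHooked (suc r) ⊎ Hooked (suc r)
doublyHooked⊎hooked r with mod4 r
... | 0+4 zero    = inj₂ hooked-2
... | 0+4 (suc u) = inj₂ (hooked₂ u)
... | 1+4 zero    = inj₂ hooked-3
... | 1+4 (suc u) = inj₂ (hooked₃ u)
... | 2+4 zero    = inj₁ doublyHooked-4
... | 2+4 (suc u) = inj₁ (doublyHooked₀ u)
... | 3+4 u       = inj₁ (doublyHooked₁ u)

-- Reversing a hooked pairing

triVertex⁺ : ∀ {T xy x} → xy ∈ T → x ∈ triVertices xy → TriVertex T x
triVertex⁺ xy∈ x∈ = ∈-concatMap⁺ triVertices (lose xy∈ x∈)

length-triVertices : ∀ T → length (concatMap triVertices T) ≡ 2 * length T
length-triVertices []      = refl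
length-triVertices (_ ∷ T) = trans (cong (2 +_) (length-triVertices T)) (sym (*-suc 2 (length T)))

module _ {r : ℕ} (π : Hooked r) where

  private
    T = pairs π
    c = 2 * r + 4
    mirror : Triangle → Triangle
    mirror (x , y) = c ∸ y , c ∸ x

    run : Run (TriVertex T) 1 (2 * r + 3 + 1) (2 * r + 1 + 1)
    run = blockRun (proj₁ (positions π)) ▹ proj₂ (positions π) after 1 by solve (r ∷ [])

    -- By counting, the pairing has no positions besides the listed ones, so the truncated
    -- subtraction in `mirror` is a true reflection.
    bounded : ∀ {x} → TriVertex T x → x ≤ c
    bounded {x} x∈ = <⇒≤ (subst (x <_) end≡ (All.lookup (values-< run) (∈-resp-↭ (↭-sym perm) x∈)))
      where
      end≡ : 2 * r + 3 + 1 ≡ 2 * r + 4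
      end≡ = solve (r ∷ [])
      count : 2 * suc r ≡ 2 * r + 1 + 1
      count = solve (r ∷ [])
      2T≡ : length (concatMap triVertices T) ≡ length (values run)
      2T≡ = trans (length-triVertices T) (trans (cong (2 *_) (size π)) (trans count (sym (values-length run))))
      perm : values run ↭ concatMap triVertices T
      perm = uniqueCover⇒↭ (values-unique run) (All.lookup (values-satisfy run)) (≤-reflexive 2T≡)

    mirror-vertex : ∀ {x y} → TriVertex T x → x + y ≡ c → TriVertex (map mirror T) y
    mirror-vertex {x} {y} x∈ x+y≡c = subst (TriVertex (map mirror T)) (trans (cong (_∸ x) (sym x+y≡c)) (m+n∸m≡n x y)) (reflected x∈)
      where
      reflected : TriVertex T x → TriVertex (map mirror T) (c ∸ x)
      reflected x∈ with find (∈-concatMap⁻ triVertices {xs = T} x∈)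
      ... | _ , xy∈ , here refl         = triVertex⁺ (∈-map⁺ mirror xy∈) (there (here refl))
      ... | _ , xy∈ , there (here refl) = triVertex⁺ (∈-map⁺ mirror xy∈) (here refl)

    mirror-difference : ∀ {d} → Difference T d → Difference (map mirror T) d
    mirror-difference {d} d∈ with find d∈
    ... | (x , _) , xy∈ , refl = lose (∈-map⁺ mirror xy∈) (begin
      c ∸ x             ≡⟨ m∸n+n≡m d≤ ⟨
      c ∸ x ∸ d + d     ≡⟨ cong (_+ d) (∸-+-assoc c x d) ⟩
      c ∸ (x + d) + d   ∎)
      where
      open ≡-Reasoning
      d≤ : d ≤ c ∸ x
      d≤ = m+n≤o⇒m≤o∸n d (subst (_≤ c) (+-comm x d) (bounded (triVertex⁺ xy∈ (there (here refl)))))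

  -- Reflection in 2t + 2 preserves differences, takes the hook 2t + 1 to 1 and moves the hole from
  -- 2t to 2.
  reverse : ReverseHooked r
  reverse = record
    { pairs       = map mirror T
    ; size        = trans (length-map mirror T) (size π)
    ; differences = mapBlock mirror-difference (differences π)
    ; positions   = single (mirror-vertex (at (proj₂ (positions π)) 0 (s≤s z≤n)) hook)
                  , blockᵒ λ i j eq → mirror-vertex (at (proj₁ (positions π)) i (subst (i <_) eq (s≤s (m≤m+n i j)))) (opposite i j eq)
    }
    where
    hook : 2 * r + 3 + 0 + 1 ≡ 2 * r + 4
    hook = solve (r ∷ [])
    split : ∀ i j → 1 + i + (3 + j) ≡ suc (i + j) + 3
    split i j = solve (i ∷ j ∷ [])
    merge : 2 * r + 1 + 3 ≡ 2 * r + 4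
    merge = solve (r ∷ [])
    opposite : ∀ i j → suc (i + j) ≡ 2 * r + 1 → 1 + i + (3 + j) ≡ 2 * r + 4
    opposite i j eq = trans (split i j) (trans (cong (_+ 3) eq) merge)

-- Assembling triangles and hexagons

place : ℕ → List Triangle → List Triangle
place o = map λ (x , y) → o + x , o + y

module _ (o : ℕ) {T : List Triangle} where

  place-vertex : ∀ {x} → TriVertex T x → TriVertex (place o T) (o + x)
  place-vertex x∈ with find (∈-concatMap⁻ triVertices {xs = T} x∈)
  ... | _ , xy∈ , here refl         = triVertex⁺ (∈-map⁺ _ xy∈) (here refl)
  ... | _ , xy∈ , there (here refl) = triVertex⁺ (∈-map⁺ _ xy∈) (there (here refl))

  -- Edges to the centre shift along with the vertices, whereas the third edge of each triangle
  -- keeps its difference.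
  place-spoke : ∀ {x} → TriVertex T x → TriEdge (place o T) (o + x)
  place-spoke x∈ with find (∈-concatMap⁻ triVertices {xs = T} x∈)
  ... | _ , xy∈ , here refl         = ∈-concatMap⁺ triEdges (lose (∈-map⁺ _ xy∈) (here refl))
  ... | _ , xy∈ , there (here refl) = ∈-concatMap⁺ triEdges (lose (∈-map⁺ _ xy∈) (there (there (here refl))))

  place-difference : ∀ {d} → Difference T d → TriEdge (place o T) d
  place-difference {d} d∈ with find d∈
  ... | (x , _) , xy∈ , refl = ∈-concatMap⁺ triEdges (lose (∈-map⁺ _ xy∈) (there (here (sym
    (trans (∣m+n-m+o∣≡∣n-o∣ o x (x + d)) (∣m-m+n∣≡n x d))))))

-- Replaces the list lengths in the type of the graph by `t` and `h`, so that the arithmetic side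
-- conditions become polynomial identities.
sized⇒graceful : ∀ {T H t h} → length T ≡ t → length H ≡ h →
  Run (VertexLabel T H) 0 (suc (3 * t + 6 * h)) (1 + 2 * t + 5 * h) → Block (EdgeLabel T H) 1 (3 * t + 6 * h) → Graceful (C3tC6h t h) (3 * t + 6 * h)
sized⇒graceful {T} {H} refl refl = blocks⇒graceful T H

sized⇒nearGraceful : ∀ {T H t h} → length T ≡ t → length H ≡ h →
  3 * t + 6 * h ≡ suc p → Run (VertexLabel T H) 0 (2 + (3 * t + 6 * h)) (1 + 2 * t + 5 * h) →
  Block (EdgeLabel T H) 1 p → Block (EdgeLabel T H) (suc (3 * t + 6 * h)) 1 → NearGraceful (C3tC6h t h) (3 * t + 6 * h)
sized⇒nearGraceful {T = T} {H} refl refl eq vs es top =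
  blocks⇒nearGraceful T H eq vs es (subst (EdgeLabel T H) (+-identityʳ _) (at top 0 (s≤s z≤n)))

module Assembly {t h : ℕ} (T : List Triangle) (H : List Hexagon) (o : ℕ) (|T| : length T ≡ t) (|H| : length H ≡ h) where

  private
    T′ = place o T

  centreRun : Run (HexVertex H) 1 hi n → Run (VertexLabel T′ H) 0 hi (suc n)
  centreRun r = append (blockRun (single (inj₁ refl))) ≤-refl (mapRun (inj₂ ∘ inj₂) r)

  hexVs : Block (HexVertex H) a n → Block (VertexLabel T′ H) a n
  hexVs = mapBlock (inj₂ ∘ inj₂)

  triVs : Block (TriVertex T) a n → Block (VertexLabel T′ H) (o + a) n
  triVs = translate o (inj₂ ∘ inj₁ ∘ place-vertex o {T})

  hexEs : Block (HexEdge H) a n → Block (EdgeLabel T′ H) a n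
  hexEs = mapBlock inj₂

  spokes : Block (TriVertex T) a n → o + a ≡ b → Block (EdgeLabel T′ H) b n
  spokes bl refl = translate o (inj₁ ∘ place-spoke o {T}) bl

  triDs : Block (Difference T) a n → Block (EdgeLabel T′ H) a n
  triDs = mapBlock (inj₁ ∘ place-difference o {T})

  graceful : Run (VertexLabel T′ H) 0 (suc (3 * t + 6 * h)) (1 + 2 * t + 5 * h) → Block (EdgeLabel T′ H) 1 (3 * t + 6 * h) → Graceful (C3tC6h t h) (3 * t + 6 * h)
  graceful = sized⇒graceful {T = T′} {H} (trans (length-map _ T) |T|) |H|

  nearGraceful : 3 * t + 6 * h ≡ suc p → Run (VertexLabel T′ H) 0 (2 + (3 * t + 6 * h)) (1 + 2 * t + 5 * h) →
    Block (EdgeLabel T′ H) 1 p → Block (EdgeLabel T′ H) (suc (3 * t + 6 * h)) 1 → NearGraceful (C3tC6h t h) (3 * t + 6 * h)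
  nearGraceful = sized⇒nearGraceful {T = T′} {H} (trans (length-map _ T) |T|) |H|

module EvenCase (t k τ : ℕ) (t≡ : t ≡ suc k + τ) (T : List Triangle) (|T| : length T ≡ t) where

  private
    Φ = evenFamilies t k
    H = hexagons Φ

    |H| : length H ≡ 2 * k + 2
    |H| = trans (length-hexagons Φ) sizes
      where
      sizes : k + (k + (1 + (1 + 0))) ≡ 2 * k + 2
      sizes = solve (k ∷ [])

    -- Differences and hexagons use the edge labels up to t + 12k + 12, and the pairing is placed
    -- directly above them.
    open Assembly T H (t + (12 * k + 12)) |T| |H|

    vertexRun : Run (VertexLabel (place (t + (12 * k + 12)) T) H) 0 (t + (12 * k + 13)) (suc (10 * k + 10))
    vertexRun = centreRun (evenHexagons-vertices t k τ t≡)

    edgeBlock : Block (Difference T) 1 t → Block (EdgeLabel (place (t + (12 * k + 12)) T) H) 1 (t + (12 * k + 12))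
    edgeBlock ds = triDs ds ▸ hexEs (evenHexagons-edges t k)

  even-graceful : Block (Difference T) 1 t → Block (TriVertex T) 1 (2 * t) →
    Graceful (C3tC6h t (2 * k + 2)) (edgesC3tC6h t (2 * k + 2))
  even-graceful ds ps = graceful
    (runTo (vertexRun ▹ triVs ps after 0 by solve (t ∷ k ∷ [])) (solve (t ∷ k ∷ [])) (solve (t ∷ k ∷ [])))
    ((edgeBlock ds ▸ spokes ps (solve (t ∷ k ∷ []))) ⟫ solve (t ∷ k ∷ []))

  even-nearGraceful : ∀ {r} → t ≡ suc r → Block (Difference T) 1 t →
    Block (TriVertex T) 1 (2 * r + 1) → Block (TriVertex T) (2 * r + 3) 1 →
    NearGraceful (C3tC6h t (2 * k + 2)) (edgesC3tC6h t (2 * k + 2))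
  -- With m edges, `p` is m - 1. Position 2t falls on m and is skipped; the hook 2t + 1 falls on m +
  -- 1.
  even-nearGraceful {r} refl ds ps top = nearGraceful {p = 3 * r + 12 * k + 14} (solve (r ∷ k ∷ []))
    (runTo (vertexRun ▹ triVs ps after 0 by solve (r ∷ k ∷ []) ▹ triVs top after 1 by solve (r ∷ k ∷ []))
      (solve (r ∷ k ∷ [])) (solve (r ∷ k ∷ [])))
    ((edgeBlock ds ▸ spokes ps (solve (r ∷ k ∷ []))) ⟫ solve (r ∷ k ∷ []))
    (spokes top (solve (r ∷ k ∷ [])))

module OddCase (r k τ : ℕ) (t≡ : suc r ≡ k + τ) (T : List Triangle) (|T| : length T ≡ suc r) where

  private
    Φ = oddFamilies (suc r) k
    H = hexagons Φ

    |H| : length H ≡ 2 * k + 1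
    |H| = trans (length-hexagons Φ) sizes
      where
      sizes : k + (k + (1 + 0)) ≡ 2 * k + 1
      sizes = solve (k ∷ [])

    -- This offset puts the hole at position 2 on t + 12k + 7, the withheld label of the single
    -- hexagon.
    open Assembly T H (suc r + (12 * k + 5)) |T| |H|
    open Hexagons Φ

    vertexRun : Block (TriVertex T) 1 1 → Block (TriVertex T) 3 n →
      Run (VertexLabel (place (suc r + (12 * k + 5)) T) H) 0 (suc r + (12 * k + 5) + 3 + n) (suc (10 * k + 4) + 1 + 1 + n)
    vertexRun p ps = centreRun (oddHexagons-vertices (suc r) k τ t≡)
      ▹ triVs p after 0 by solve (r ∷ k ∷ [])
      ▹ hexVs (high₁ #2 refl) after 0 by solve (r ∷ k ∷ [])
      ▹ triVs ps after 0 by solve (r ∷ k ∷ [])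

    edgeBlock : Block (Difference T) 1 (suc r) → Block (TriVertex T) 1 1 → Block (TriVertex T) 3 n →
      Block (EdgeLabel (place (suc r + (12 * k + 5)) T) H) 1 (suc r + (12 * k + 5) + 1 + 1 + n)
    edgeBlock ds p ps = triDs ds ▸ hexEs (oddHexagons-edges (suc r) k)
      ▸ spokes p (solve (r ∷ k ∷ []))
      ▸ hexEs (edge₁ #2 (solve (r ∷ k ∷ [])))
      ▸ spokes ps (solve (r ∷ k ∷ []))

  odd-graceful : Block (Difference T) 1 (suc r) → Block (TriVertex T) 1 1 → Block (TriVertex T) 3 (2 * r + 1) →
    Graceful (C3tC6h (suc r) (2 * k + 1)) (edgesC3tC6h (suc r) (2 * k + 1))
  odd-graceful ds p ps = graceful
    (runTo (vertexRun p ps) (solve (r ∷ k ∷ [])) (solve (r ∷ k ∷ [])))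
    (edgeBlock ds p ps ⟫ solve (r ∷ k ∷ []))

  odd-nearGraceful : Block (Difference T) 1 (suc r) → Block (TriVertex T) 1 1 → Block (TriVertex T) 3 (2 * r) →
    Block (TriVertex T) (2 * r + 4) 1 → NearGraceful (C3tC6h (suc r) (2 * k + 1)) (edgesC3tC6h (suc r) (2 * k + 1))
  -- Again `p` is m - 1: the skipped position 2t + 1 falls on m, the hook 2t + 2 on m + 1.
  odd-nearGraceful ds p ps top = nearGraceful {p = 3 * r + 12 * k + 8} (solve (r ∷ k ∷ []))
    (runTo (vertexRun p ps ▹ triVs top after 1 by solve (r ∷ k ∷ [])) (solve (r ∷ k ∷ [])) (solve (r ∷ k ∷ [])))
    (edgeBlock ds p ps ⟫ solve (r ∷ k ∷ []))
    (spokes top (solve (r ∷ k ∷ [])))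

-- One triangle with one or three hexagons

-- Here the triangle lies among the smallest labels: it takes the edge labels 1, 2, 3 and leaves all
-- others to the hexagons. The same holds for `nearGraceful-1-3`.
nearGraceful-1-1 : NearGraceful (C3tC6h 1 1) (edgesC3tC6h 1 1)
nearGraceful-1-1 = blocks⇒nearGraceful T H refl
  ( blockRun (from-yes (block? (vertexLabel? T H) 0 4))
    ▹ from-yes (block? (vertexLabel? T H) 5 1) after 1 by refl
    ▹ from-yes (block? (vertexLabel? T H) 8 3) after 2 by refl )
  (from-yes (block? (edgeLabel? T H) 1 8)) (from-yes (edgeLabel? T H 10))
  where
  T = (1 , 3) ∷ []
  H = hexagon 10 5 9 2 8 ∷ []

nearGraceful-1-3 : NearGraceful (C3tC6h 1 3) (edgesC3tC6h 1 3)
nearGraceful-1-3 = blocks⇒nearGraceful T H refl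
  ( blockRun (from-yes (block? (vertexLabel? T H) 0 6))
    ▹ from-yes (block? (vertexLabel? T H) 7 1) after 1 by refl
    ▹ from-yes (block? (vertexLabel? T H) 10 1) after 2 by refl
    ▹ from-yes (block? (vertexLabel? T H) 13 10) after 2 by refl )
  (from-yes (block? (edgeLabel? T H) 1 20)) (from-yes (edgeLabel? T H 22))
  where
  T = (1 , 3) ∷ []
  H = hexagon 22 17 21 10 16 ∷ hexagon 20 7 14 2 19 ∷ hexagon 18 4 13 5 15 ∷ []

-- Case distinction on the parity of h

Conclusion : ℕ → ℕ → Set
Conclusion t h = Graceful (C3tC6h t h) (edgesC3tC6h t h) ⊎ NearGraceful (C3tC6h t h) (edgesC3tC6h t h)

evenHexagons : ∀ r k → k ≤ r → Conclusion (suc r) (2 * k + 2)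
evenHexagons r k k≤r with m≤n⇒∃[o]m+o≡n k≤r | skolem⊎hooked r
... | τ , eq | inj₁ π = inj₁ (even-graceful (differences π) (positions π))
  where open EvenCase (suc r) k τ (cong suc (sym eq)) (pairs π) (size π)
... | τ , eq | inj₂ π = inj₂ (even-nearGraceful refl (differences π) (proj₁ (positions π)) (proj₂ (positions π)))
  where open EvenCase (suc r) k τ (cong suc (sym eq)) (pairs π) (size π)

oddHexagons : ∀ r k → k ≤ suc r → Conclusion (suc r) (2 * k + 1)
-- For t = 1 the bound k ≤ 1 leaves only h = 1 and h = 3.
oddHexagons zero zero          _ = inj₂ nearGraceful-1-1
oddHexagons zero (suc zero)    _ = inj₂ nearGraceful-1-3
oddHexagons zero (suc (suc _)) (s≤s ())
oddHexagons (suc r) k k≤ with m≤n⇒∃[o]m+o≡n k≤ | doublyHooked⊎hooked r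
... | τ , eq | inj₁ π = let p , ps , top = positions π in inj₂ (odd-nearGraceful (differences π) p ps top)
  where open OddCase (suc r) k τ (sym eq) (pairs π) (size π)
... | τ , eq | inj₂ π = inj₁ (odd-graceful (differences ρ) (proj₁ (positions ρ)) (proj₂ (positions ρ)))
  where
  ρ = reverse π
  open OddCase (suc r) k τ (sym eq) (pairs ρ) (size ρ)

theorem6p3 : (t h : ℕ) → 1 ≤ t → 1 ≤ h → h ≤ 2 * t + 1 →
    Graceful (C3tC6h t h) (edgesC3tC6h t h) ⊎ NearGraceful (C3tC6h t h) (edgesC3tC6h t h)
theorem6p3 (suc r) h _ 1≤h h≤ with halve h
... | k , inj₂ refl = subst (Conclusion (suc r)) odd
  -- From 2k + 1 ≤ 2t + 1 follows k ≤ t.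
  (oddHexagons r k (*-cancelˡ-≤ 2 (+-cancelʳ-≤ 1 (2 * k) (2 * suc r) (subst (_≤ 2 * suc r + 1) (sym odd) h≤))))
  where
  odd : 2 * k + 1 ≡ suc (k + k)
  odd = solve (k ∷ [])
theorem6p3 (suc r) _ _ () _ | zero , inj₁ refl
theorem6p3 (suc r) _ _ _ h≤ | suc k , inj₁ refl = subst (Conclusion (suc r)) even
  -- From 2k + 2 ≤ 2t + 1 follows 2k < 2t, hence k < t: parity sharpens the bound by one.
  (evenHexagons r k (≤-pred (*-cancelˡ-< 2 k (suc r) (+-cancelʳ-≤ 1 (suc (2 * k)) (2 * suc r)
    (subst (_≤ 2 * suc r + 1) even′ h≤)))))
  where
  even : 2 * k + 2 ≡ suc k + suc k
  even = solve (k ∷ [])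
  even′ : suc k + suc k ≡ suc (2 * k) + 1
  even′ = solve (k ∷ [])
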